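{- Assume excluded middle. For a predicate $T$ on lists let $T^{c}$ denote its complement, $T^{c} := \lambda u.\ u\notin T$. (1) For every type $A$ and every $T:\mathcal P(A^*)$, the Teichmüller-Tukey lemma $\mathrm{TTL}_{A,T}$ is equivalent to generalised update induction $\mathrm{GUI}_{A,T^{c}}$. (2) For every type $A$ and every $T:\mathcal P(A_\bot^*)$, the countable Teichmüller-Tukey lemma $\mathrm{TTL}^{\mathbb N}_{A,T}$ is equivalent to update induction $\mathrm{UI}_{A,T^{c}}$.
   Context: Setting: intuitionistic higher-order arithmetic with inductive types and extensional equality of predicates (here with excluded middle added; no choice principle is assumed). $\mathcal P(A)$ denotes $A\to \mathrm{Prop}$ ("subsets of $A$"), with $a\in P$ meaning $P(a)$. $A^*$ is the type of finite lists over $A$; $a\in u$ means $a$ occurs in the list $u$. $A_\bot := A+\mathbf 1$, with $a:A$ identified with its left injection and $\bot$ the extra element. $A_\bot^{\mathbb N}$ is the type $\mathbb N\to A_\bot$, and $A_\bot^*$ is the type of lists over $A_\bot$. Arbitrary subsets. For $u:A^*$, $\alpha:\mathcal P(A)$: $u\subset\alpha$ means $\forall a,\ a\in u\to a\in\alpha$. For $T:\mathcal P(A^*)$: $\langle T\rangle := \{\alpha:\mathcal P(A)\mid \forall u^{A^*},\ u\subset\alpha\to u\in T\}$ and $\langle T\rangle^{\circ} := \{\alpha:\mathcal P(A)\mid\exists u^{A^*},\ u\subset\alpha\wedge u\in T\}$. For $\alpha,\beta:\mathcal P(A)$: $\beta\prec\alpha$ means there is $a:A$ with $a\notin\alpha$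 and $\beta=\lambda x.\,(x\in\alpha\vee x=a)$ (so $\beta$ extends $\alpha$). For $P:\mathcal P(\mathcal P(A))$: $\alpha\in\mathrm{Max}_\prec(P)$ means $\alpha\in P$ and $\forall\beta,\ \beta\prec\alpha\to\beta\notin P$. - $\mathrm{TTL}_{A,T}$: $(\exists\alpha^{\mathcal P(A)},\ \alpha\in\langle T\rangle)\to\exists\alpha^{\mathcal P(A)},\ \alpha\in\mathrm{Max}_\prec(\langle T\rangle)$. - $\mathrm{GUI}_{A,T}$: $\big(\forall\alpha^{\mathcal P(A)},\ [(\forall\beta^{\mathcal P(A)},\ \beta\prec\alpha\to\beta\in\langle T\rangle^\circ)\to\alpha\in\langle T\rangle^\circ]\big)\to\forall\alpha^{\mathcal P(A)},\ \alpha\in\langle T\rangle^\circ$. Countable subsets. For $\alpha:A_\bot^{\mathbb N}$, $\alpha_{|n}$ is the list $[\alpha(0),\dots,\alpha(n-1)]$; for $u:A_\bot^*$, $u\subset_{\mathbb N}\alpha$ means $\exists n,\ u=\alpha_{|n}$. For $T:\mathcal P(A_\bot^*)$: $\langle T\rangle_{\mathbb N} := \{\alpha\mid\forall u^{A_\bot^*},\ u\subset_{\mathbb N}\alpha\to u\in T\}$ and $\langle T\rangle^{\circ}_{\mathbb N} := \{\alpha\mid\exists u^{A_\bot^*},\ u\subset_{\mathbb N}\alpha\wedge u\in T\}$. For $\alpha,\beta:A_\bot^{\mathbb N}$: $\beta\prec_{\mathbb N}\alpha$ means there are $m:\mathbb N$ and $a:A$ with $\alpha(m)=\bot$, $\beta(m)=a$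 and $\alpha(n)=\beta(n)$ for all $n\neq m$. $\alpha\in\mathrm{Max}_{\prec_{\mathbb N}}(P)$ means $\alpha\in P$ and $\forall\beta,\ \beta\prec_{\mathbb N}\alpha\to\beta\notin P$. - $\mathrm{TTL}^{\mathbb N}_{A,T}$: $(\exists\alpha^{A_\bot^{\mathbb N}},\ \alpha\in\langle T\rangle_{\mathbb N})\to\exists\alpha^{A_\bot^{\mathbb N}},\ \alpha\in\mathrm{Max}_{\prec_{\mathbb N}}(\langle T\rangle_{\mathbb N})$. - $\mathrm{UI}_{A,T}$: $\big(\forall\alpha^{A_\bot^{\mathbb N}},\ [(\forall\beta^{A_\bot^{\mathbb N}},\ \beta\prec_{\mathbb N}\alpha\to\beta\in\langle T\rangle^\circ_{\mathbb N})\to\alpha\in\langle T\rangle^\circ_{\mathbb N}]\big)\to\forall\alpha^{A_\bot^{\mathbb N}},\ \alpha\in\langle T\rangle^\circ_{\mathbb N}$. -}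

module Defs where

open import Level using (Level; _⊔_; suc)
open import Data.List.Base using (List; applyUpTo)
open import Data.List.Membership.Propositional using () renaming (_∈_ to _∈ᴸ_)
open import Data.Maybe.Base using (Maybe; just; nothing)
open import Data.Nat.Base using (ℕ)
open import Data.Product.Base using (_×_; ∃-syntax; ∃₂)
open import Relation.Binary.Core using (Rel)
open import Relation.Binary.PropositionalEquality.Core using (_≡_; _≢_; refl)
open import Relation.Nullary using (Dec; ¬_; Irrelevant)
open import Relation.Unary using (Pred; _∪_; _≐_; ｛_｝)

private
  variable
    a ℓ p r : Level
    A X : Set a

-- Prop of higher-order arithmetic is rendered by the types with at most one
-- inhabitant, not by Set: excluded middle for all of Set would provide a global
-- choice function, and Σ in place of ∃ would provide chosen witnesses.

record Ω (ℓ : Level) : Set (suc ℓ) where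
  field
    holds      : Set ℓ
    irrelevant : Irrelevant holds

open Ω public

-- The second-order encoding of the proposition "X is inhabited"; the logical
-- ∃ x, P x is ∥ ∃[ x ] P x ∥.

∥_∥ : ∀ {x} → Set x → Set (suc x)
∥_∥ {x} X = (P : Ω x) → (X → holds P) → holds P

-- No truncation is needed here: P ⊎ ¬ P has at most one inhabitant when P does.

ExcludedMiddleΩ : ∀ ℓ → Set (suc ℓ)
ExcludedMiddleΩ ℓ = (P : Ω ℓ) → Dec (holds P)

𝒫 : ∀ {a} → Set a → (ℓ : Level) → Set (a ⊔ suc ℓ)
𝒫 A ℓ = A → Ω ℓ

infix 4 _∈_ _∉_

⌊_⌋ : 𝒫 A ℓ → Pred A ℓ
⌊ P ⌋ x = holds (P x)

_∈_ : A → 𝒫 A ℓ → Set ℓ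
x ∈ P = holds (P x)

_∉_ : A → 𝒫 A ℓ → Set ℓ
x ∉ P = ¬ (x ∈ P)

-- Negations are definitionally proof-irrelevant because the library's ⊥ is.

_ᶜ : 𝒫 A ℓ → 𝒫 A ℓ
(T ᶜ) u = record { holds = u ∉ T ; irrelevant = λ _ _ → refl }

-- β ≺ α says that β is an immediate extension of α.

Max : Rel X r → Pred X p → Pred X _
Max _≺_ P α = P α × (∀ β → β ≺ α → ¬ P β)

module _ {A : Set a} where

  infix 4 _⊂_ _≺_

  _⊂_ : List A → 𝒫 A ℓ → Set _
  u ⊂ α = ∀ x → x ∈ᴸ u → x ∈ α

  ⟨_⟩ : 𝒫 (List A) ℓ → Pred (𝒫 A ℓ) _
  ⟨ T ⟩ α = ∀ u → u ⊂ α → u ∈ T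

  ⟨_⟩° : 𝒫 (List A) ℓ → Pred (𝒫 A ℓ) _
  ⟨ T ⟩° α = ∥ ∃[ u ] (u ⊂ α × u ∈ T) ∥

  -- Equality of predicates is extensional, hence _≐_.  The union of α and ｛ x ｝
  -- has at most one proof at each point, since x ∉ α.
  _≺_ : Rel (𝒫 A ℓ) _
  β ≺ α = ∥ ∃[ x ] (x ∉ α × ⌊ β ⌋ ≐ (⌊ α ⌋ ∪ ｛ x ｝)) ∥

  TTL : 𝒫 (List A) ℓ → Set _
  TTL T = ∥ ∃[ α ] ⟨ T ⟩ α ∥ → ∥ ∃[ α ] Max _≺_ ⟨ T ⟩ α ∥

  GUI : 𝒫 (List A) ℓ → Set _
  GUI T = (∀ α → (∀ β → β ≺ α → ⟨ T ⟩° β) → ⟨ T ⟩° α) → ∀ α → ⟨ T ⟩° α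

-- A⊥ is Maybe A, with ⊥ as nothing.

module _ {A : Set a} where

  infix 4 _⊂ℕ_ _≺ℕ_

  _⊂ℕ_ : List (Maybe A) → (ℕ → Maybe A) → Set _
  u ⊂ℕ α = ∥ ∃[ n ] u ≡ applyUpTo α n ∥

  ⟨_⟩ℕ : 𝒫 (List (Maybe A)) ℓ → Pred (ℕ → Maybe A) _
  ⟨ T ⟩ℕ α = ∀ u → u ⊂ℕ α → u ∈ T

  ⟨_⟩°ℕ : 𝒫 (List (Maybe A)) ℓ → Pred (ℕ → Maybe A) _
  ⟨ T ⟩°ℕ α = ∥ ∃[ u ] (u ⊂ℕ α × u ∈ T) ∥

  _≺ℕ_ : Rel (ℕ → Maybe A) _
  β ≺ℕ α = ∥ ∃₂ (λ m x → α m ≡ nothing × β m ≡ just x × (∀ n → n ≢ m → α n ≡ β n)) ∥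

  TTLℕ : 𝒫 (List (Maybe A)) ℓ → Set _
  TTLℕ T = ∥ ∃[ α ] ⟨ T ⟩ℕ α ∥ → ∥ ∃[ α ] Max _≺ℕ_ ⟨ T ⟩ℕ α ∥

  UI : 𝒫 (List (Maybe A)) ℓ → Set _
  UI T = (∀ α → (∀ β → β ≺ℕ α → ⟨ T ⟩°ℕ β) → ⟨ T ⟩°ℕ α) → ∀ α → ⟨ T ⟩°ℕ α

{-# OPTIONS --safe #-}

-- Classically, induction along ≺ is the contrapositive of the
-- existence of maximal elements: if F is the complement of P, then "F is
-- progressive along ≺" says exactly that P has no ≺-maximal element, and
-- "F holds everywhere" says that P is empty.  Excluded middle makes ⟨ Tᶜ ⟩° the
-- complement of ⟨ T ⟩, for the inclusion of lists in either kind of subset.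

module Submission where

open import Level using (Level; Lift; lift; lower)
open import Data.Empty using (⊥)
open import Data.List.Base using (List)
open import Data.Maybe.Base using (Maybe)
open import Data.Product.Base using (_×_; _,_; ∃-syntax)
open import Function.Bundles using (_⇔_; mk⇔; Equivalence)
open import Function.Base using (_∘_)
open import Relation.Binary.Core using (Rel)
open import Relation.Binary.PropositionalEquality.Core using (refl)
open import Relation.Nullary using (¬_)
open import Relation.Nullary.Decidable using (decidable-stable)
open import Relation.Unary using (Pred)
open import Defs

private
  variable
    x r p q ℓ : Level
    X U : Set x

-- The encoding is instantiated at falsity, lifted because it quantifies only over `Ω x`.
∥∥⇒¬¬ : ∥ X ∥ → ¬ ¬ X
∥∥⇒¬¬ {x} ∥X∥ ¬X =
  lower (∥X∥ (record { holds = Lift x ⊥ ; irrelevant = λ _ _ → refl }) (lift ∘ ¬X))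

module _ (em : ∀ {e} → ExcludedMiddleΩ e) where

  -- Excluded middle decides the target `P`, never `X`, which may have many inhabitants.
  ¬¬⇒∥∥ : ¬ ¬ X → ∥ X ∥
  ¬¬⇒∥∥ ¬¬X P f = decidable-stable (em P) (λ ¬P → ¬¬X (¬P ∘ f))

  ∃-counterexample⇔¬∀ : (R : Pred U r) (T : 𝒫 U ℓ) →
    ∥ ∃[ u ] (R u × u ∈ T ᶜ) ∥ ⇔ (¬ (∀ u → R u → u ∈ T))
  ∃-counterexample⇔¬∀ R T = mk⇔
    (λ ex all → ∥∥⇒¬¬ ex λ (u , Ru , u∉T) → u∉T (all u Ru))
    (λ ¬all → ¬¬⇒∥∥ λ ¬ex → ¬all λ u Ru →
      decidable-stable (em (T u)) λ u∉T → ¬ex (u , Ru , u∉T))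

  maximal⇔induction : (_≺_ : Rel X r) (P : Pred X p) (F : Pred X q) →
    (∀ α → F α ⇔ (¬ P α)) →
    (∥ ∃[ α ] P α ∥ → ∥ ∃[ α ] Max _≺_ P α ∥)
      ⇔ ((∀ α → (∀ β → β ≺ α → F β) → F α) → ∀ α → F α)
  maximal⇔induction _≺_ P F F⇔¬P = mk⇔
    (λ max prog α → ¬P⇒F λ Pα →
      -- The goal is now `⊥`, so the truncated maximal element may be unpacked.
      ∥∥⇒¬¬ (max λ _ f → f (α , Pα)) λ (γ , Pγ , γ-max) →
        F⇒¬P (prog γ λ β β≺γ → ¬P⇒F (γ-max β β≺γ)) Pγ)
    (λ ind ∃P → ¬¬⇒∥∥ λ ¬max → ∥∥⇒¬¬ ∃P λ (α , Pα) →
      F⇒¬P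
        -- A `γ` in `P` with `F` at every `β ≺ γ` would be maximal.
        (ind (λ γ above → ¬P⇒F λ Pγ →
          ¬max (γ , Pγ , λ β β≺γ → F⇒¬P (above β β≺γ))) α)
        Pα)
    where
    F⇒¬P : ∀ {α} → F α → ¬ P α
    F⇒¬P {α} = Equivalence.to (F⇔¬P α)

    ¬P⇒F : ∀ {α} → ¬ P α → F α
    ¬P⇒F {α} = Equivalence.from (F⇔¬P α)

mainTheorem1 : (em : ∀ {e} → ExcludedMiddleΩ e) → ∀ {a ℓ : Level} →
    ((A : Set a) (T : 𝒫 (List A) ℓ) → TTL T ⇔ GUI (T ᶜ))
    × ((A : Set a) (T : 𝒫 (List (Maybe A)) ℓ) → TTLℕ T ⇔ UI (T ᶜ))
mainTheorem1 em =
    (λ A T → maximal⇔induction em _≺_ ⟨ T ⟩ ⟨ T ᶜ ⟩°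
      λ α → ∃-counterexample⇔¬∀ em (_⊂ α) T)
  , (λ A T → maximal⇔induction em _≺ℕ_ ⟨ T ⟩ℕ ⟨ T ᶜ ⟩°ℕ
      λ α → ∃-counterexample⇔¬∀ em (_⊂ℕ α) T)
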